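{- Let $a,b$ be positive integers and $h(j)=aj+b$ for $j\ge0$, $h(j)=0$ for $j<0$. Then $$\operatorname{hdepth}(h)=\begin{cases}1,& a<b,\\ 2,& b\le a<2b,\\ 3,& 2b\le a<3b,\\ 4,& 3b\le a\le 4b,\\ 3,& a>4b.\end{cases}$$
   Context: For a nonzero function $h:\mathbb Z\to\mathbb Z_{\ge 0}$ with $h(j)=0$ for all sufficiently negative $j$, and integers $k\le d$, set $\beta_k^d(h)=\sum_{j\le k}(-1)^{k-j}\binom{d-j}{k-j}h(j)$, and $\operatorname{hdepth}(h)=\max\{d\in\mathbb Z:\ \beta_k^d(h)\ge 0\text{ for all integers }k\le d\}$. -}

module Defs where

open import Data.Fin.Base using (toℕ)
open import Data.Integer.Base hiding (suc)
open import Data.Integer.Properties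
open import Data.Integer.Tactic.RingSolver using (solve-∀)
open import Data.Nat.Base as ℕ using (ℕ; zero; suc)
open import Data.Nat.Combinatorics using (_C_)
open import Data.Nat.Properties as ℕ using ()
open import Data.Product using (∃; _×_; _,_)
open import Data.Sum.Base using (inj₁; inj₂)
open import Relation.Binary.PropositionalEquality

open import Algebra.Properties.CommutativeMonoid.Sum +-0-commutativeMonoid
  using (sum-syntax; sum-cong-≗)

record HFunction : Set where
  field
    fun     : ℤ → ℕ
    bottom  : ℤ
    vanish  : ∀ j → j < bottom → fun j ≡ 0
    nonzero : ∃ λ j → fun j ≢ 0

open HFunction

-- ∑[ j from b to k ] of f j; there are max(1 + k - b, 0) summands, so the
-- sum is 0 when k < b.
sumBetween : ℤ → ℤ → (ℤ → ℤ) → ℤ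
sumBetween b k f = ∑[ i < ∣ (1ℤ + k - b) ⊔ 0ℤ ∣ ] f (b + + toℕ i)

-- Meaningful for j ≤ k ≤ d only: the absolute values are there to make
-- d - j and k - j natural numbers, and change nothing in that range.
term : (ℤ → ℕ) → (d k j : ℤ) → ℤ
term h d k j = -1ℤ ^ ∣ k - j ∣ * + (∣ d - j ∣ C ∣ k - j ∣) * + h j

-- The sum over all j ≤ k, started at `bottom`, below which every term is 0.
-- To be used for k ≤ d only. See β-bottom for independence of `bottom`.
β : HFunction → (d k : ℤ) → ℤ
β h d k = sumBetween (bottom h) k (term (fun h) d k)

IsMaximum : (ℤ → Set) → ℤ → Set
IsMaximum P m = P m × (∀ d → P d → d ≤ m)

-- "hdepth(h) = m", as a relation between h and m.
HDepth : HFunction → ℤ → Set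
HDepth h = IsMaximum (λ d → ∀ k → k ≤ d → 0ℤ ≤ β h d k)

linearFun : ℕ → ℕ → ℤ → ℕ
linearFun a b (+ j)    = a ℕ.* j ℕ.+ b
linearFun a b -[1+ _ ] = 0

linear : (a b : ℕ) .{{_ : ℕ.NonZero b}} → HFunction
linear a b = record
  { fun     = linearFun a b
  ; bottom  = 0ℤ
  ; vanish  = λ { -[1+ _ ] _ → refl ; (+ _) (+<+ ()) }
  ; nonzero = 0ℤ , λ h0≡0 → ℕ.≢-nonZero⁻¹ b
      (trans (sym (cong (ℕ._+ b) (ℕ.*-zeroʳ a))) h0≡0)
  }

HDepth-unique : ∀ h {m n} → HDepth h m → HDepth h n → m ≡ n
HDepth-unique h (pm , m-max) (pn , n-max) =
  ≤-antisym (n-max _ pm) (m-max _ pn)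

private
  drop-zero : ∀ (f : ℤ → ℤ) b x → f b ≡ 0ℤ →
    ∑[ i < ∣ (1ℤ + x) ⊔ 0ℤ ∣ ] f (b + + toℕ i) ≡
    ∑[ i < ∣ x ⊔ 0ℤ ∣ ] f (1ℤ + b + + toℕ i)
  drop-zero f b (+ n) fb≡0 rewrite ℕ.⊔-identityʳ n = begin
    f (b + 0ℤ) + ∑[ i < n ] f (b + + suc (toℕ i))
      ≡⟨ cong₂ _+_ (trans (cong f (+-identityʳ b)) fb≡0)
           (sum-cong-≗ {n} (λ i → cong f (shift b (+ toℕ i)))) ⟩
    0ℤ + ∑[ i < n ] f (1ℤ + b + + toℕ i)
      ≡⟨ +-identityˡ _ ⟩
    ∑[ i < n ] f (1ℤ + b + + toℕ i) ∎
    where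
    open ≡-Reasoning
    shift : ∀ b i → b + (1ℤ + i) ≡ 1ℤ + b + i
    shift = solve-∀
  drop-zero f b -[1+ zero  ] fb≡0 = refl
  drop-zero f b -[1+ suc _ ] fb≡0 = refl

  sum-step : ∀ f b k → f b ≡ 0ℤ → sumBetween b k f ≡ sumBetween (1ℤ + b) k f
  sum-step f b k fb≡0 =
    trans (cong (λ x → ∑[ i < ∣ x ⊔ 0ℤ ∣ ] f (b + + toℕ i)) (eq b k))
          (drop-zero f b (1ℤ + k - (1ℤ + b)) fb≡0)
    where
    eq : ∀ b k → 1ℤ + k - b ≡ 1ℤ + (1ℤ + k - (1ℤ + b))
    eq = solve-∀

  sum-steps : ∀ f b k n → (∀ j → j < b + + n → f j ≡ 0ℤ) →
    sumBetween b k f ≡ sumBetween (b + + n) k f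
  sum-steps f b k zero    _  = cong (λ c → sumBetween c k f) (sym (+-identityʳ b))
  sum-steps f b k (suc n) f0 =
    trans (sum-steps f b k n (λ j j<b+n → f0 j (<-trans j<b+n b+n<)))
      (trans (sum-step f (b + + n) k (f0 _ b+n<))
             (cong (λ c → sumBetween c k f) (eq b (+ n))))
    where
    eq : ∀ b n → 1ℤ + (b + n) ≡ b + (1ℤ + n)
    eq = solve-∀
    b+n< : b + + n < b + + suc n
    b+n< = +-monoʳ-< b (+<+ (ℕ.n<1+n n))

  sum-bottom : ∀ f b c k → b ≤ c → (∀ j → j < c → f j ≡ 0ℤ) →
    sumBetween b k f ≡ sumBetween c k f
  sum-bottom f b c k b≤c f0 =
    trans (sum-steps f b k ∣ c - b ∣ (λ j j< → f0 j (subst (j <_) c≡ j<)))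
          (cong (λ x → sumBetween x k f) c≡)
    where
    eq : ∀ b c → b + (c - b) ≡ c
    eq = solve-∀
    c≡ : b + + ∣ c - b ∣ ≡ c
    c≡ = trans (cong (λ x → b + x) (0≤i⇒+∣i∣≡i (i≤j⇒0≤j-i b≤c))) (eq b c)

  term-zero : ∀ h d k j → h j ≡ 0 → term h d k j ≡ 0ℤ
  term-zero h d k j hj≡0 = trans (cong (λ x → c * + x) hj≡0) (*-zeroʳ c)
    where c = -1ℤ ^ ∣ k - j ∣ * + (∣ d - j ∣ C ∣ k - j ∣)

β-bottom : ∀ h c d k → (∀ j → j < c → fun h j ≡ 0) →
  β h d k ≡ sumBetween c k (term (fun h) d k)
β-bottom h c d k h0 with ≤-total (bottom h) c
... | inj₁ b≤c = sum-bottom _ _ c k b≤c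
  (λ j j<c → term-zero (fun h) d k j (h0 j j<c))
... | inj₂ c≤b = sym (sum-bottom _ c _ k c≤b
  (λ j j<b → term-zero (fun h) d k j (vanish h j j<b)))

{-# OPTIONS --safe #-}

-- Pascal's rule gives β_k^{d+1} = β_k^d - β_{k-1}^d. Hence, if all β_k^{d+1}
-- are nonnegative, then by induction on k so are all β_k^d, and hdepth(h) = m
-- as soon as m is admissible and m + 1 is not. For h(j) = a j + b each β_k^d is
-- an integer combination of a and b; the obstructions are
-- β_1^{m+1} = a - m b, β_2^4 = 4b - a, and β_2^5 = 7b - 2a, where β_1^5 = a - 4b
-- and β_2^5 are never both nonnegative.
module Submission where

open import Defs
open import Data.Nat.Base using (ℕ; NonZero; _*_; _≤_; _<_; _>_)
open import Data.Integer.Base using (+_)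
open import Data.Product using (_×_)

open import Algebra.Bundles using (CommutativeRing)
open import Data.Fin.Base as Fin using (toℕ)
open import Data.Integer.Base as ℤ using (ℤ; 0ℤ; 1ℤ; -1ℤ; ∣_∣; -_; +≤+)
import Data.Integer.Properties as ℤ
open import Data.Integer.Tactic.RingSolver using (solve-∀)
open import Data.Nat.Base as ℕ using (zero; suc; z≤n; s≤s)
open import Data.Nat.Combinatorics using (_C_; nCk+nC[k+1]≡[n+1]C[k+1])
import Data.Nat.Properties as ℕ
open import Data.Product using (_,_)
open import Function.Bundles using (_⇔_; mk⇔; Equivalence)
open import Relation.Binary.PropositionalEquality
open import Relation.Nullary using (¬_; yes; no)

open import Algebra.Properties.Semiring.Sum
  (CommutativeRing.semiring ℤ.+-*-commutativeRing)
  using (sum-syntax; sum-cong-≗; ∑-distrib-+; *-distribˡ-sum)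

open HFunction
open Equivalence using (to; from)

-- Admissible degrees and Pascal's rule for `β`.

Admissible : HFunction → ℤ → Set
Admissible h d = ∀ k → k ℤ.≤ d → 0ℤ ℤ.≤ β h d k

-- The sum up to `k` has one summand more than the sum up to `k - 1`, so Pascal's rule is used at
-- the first `n` indices only and the last index is compared separately. The equation
-- `n ≡ suc (i + r)` says `i < n` and supplies the gap that `term-pascal` takes as its parameter
-- `r`.
∑-difference : ∀ n (f g h : ℕ → ℤ) →
  (∀ i r → n ≡ suc (i ℕ.+ r) → f i ≡ g i ℤ.- h i) → f n ≡ g n →
  ∑[ i < suc n ] f (toℕ i) ≡
  ∑[ i < suc n ] g (toℕ i) ℤ.- ∑[ i < n ] h (toℕ i)
∑-difference zero f g h _ fn≡gn =
  trans (cong (ℤ._+ 0ℤ) fn≡gn) (sym (ℤ.+-identityʳ _))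
∑-difference (suc n) f g h f≡g-h fn≡gn = trans
  (cong₂ ℤ._+_ (f≡g-h 0 n refl)
    (∑-difference n (λ i → f (suc i)) (λ i → g (suc i)) (λ i → h (suc i))
      (λ i r n≡ → f≡g-h (suc i) r (cong suc n≡)) fn≡gn))
  (interchange (g 0) (h 0) _ _)
  where
  interchange : ∀ w x y z →
    (w ℤ.- x) ℤ.+ (y ℤ.- z) ≡ (w ℤ.+ y) ℤ.- (x ℤ.+ z)
  interchange = solve-∀

-- Pascal's rule for the binomial coefficients; the minus sign appears because lowering `k` by one
-- flips the sign of the term. The case `j = k` must be excluded: there `k - 1 - j = -1`, and its
-- absolute value would produce a spurious coefficient.
term-pascal : ∀ h k e j r → k ≡ j ℤ.+ + suc r →
  term h (1ℤ ℤ.+ (k ℤ.+ + e)) k j ≡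
  term h (k ℤ.+ + e) k j ℤ.- term h (k ℤ.+ + e) (k ℤ.- 1ℤ) j
term-pascal h _ e j r refl = begin
  u (1ℤ ℤ.+ d ℤ.- j) (k ℤ.- j)
    ≡⟨ cong₂ u (1+d-j j (+ r) (+ e)) (k-j j (+ r)) ⟩
  u (+ suc n) (+ suc r)
    ≡⟨ cong (λ c → -1ℤ ℤ.^ suc r ℤ.* + c ℤ.* + h j)
         (nCk+nC[k+1]≡[n+1]C[k+1] n r) ⟨
  -1ℤ ℤ.^ suc r ℤ.* + (n C r ℕ.+ n C suc r) ℤ.* + h j
    ≡⟨ split (-1ℤ ℤ.^ r) (+ (n C r)) (+ (n C suc r)) (+ h j) ⟩
  u (+ n) (+ suc r) ℤ.- u (+ n) (+ r)
    ≡⟨ cong₂ ℤ._-_ (cong₂ u (d-j j (+ r) (+ e)) (k-j j (+ r)))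
                   (cong₂ u (d-j j (+ r) (+ e)) (k-1-j j (+ r))) ⟨
  u (d ℤ.- j) (k ℤ.- j) ℤ.- u (d ℤ.- j) (k ℤ.- 1ℤ ℤ.- j) ∎
  where
  open ≡-Reasoning
  k = j ℤ.+ + suc r
  d = k ℤ.+ + e
  n = suc r ℕ.+ e
  u : ℤ → ℤ → ℤ
  u n k = -1ℤ ℤ.^ ∣ k ∣ ℤ.* + (∣ n ∣ C ∣ k ∣) ℤ.* + h j
  k-j : ∀ j r → j ℤ.+ (1ℤ ℤ.+ r) ℤ.- j ≡ 1ℤ ℤ.+ r
  k-j = solve-∀
  k-1-j : ∀ j r → j ℤ.+ (1ℤ ℤ.+ r) ℤ.- 1ℤ ℤ.- j ≡ r
  k-1-j = solve-∀
  d-j : ∀ j r e → j ℤ.+ (1ℤ ℤ.+ r) ℤ.+ e ℤ.- j ≡ 1ℤ ℤ.+ r ℤ.+ e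
  d-j = solve-∀
  1+d-j : ∀ j r e →
    1ℤ ℤ.+ (j ℤ.+ (1ℤ ℤ.+ r) ℤ.+ e) ℤ.- j ≡ 1ℤ ℤ.+ (1ℤ ℤ.+ r ℤ.+ e)
  1+d-j = solve-∀
  split : ∀ s x y z →
    -1ℤ ℤ.* s ℤ.* (x ℤ.+ y) ℤ.* z ≡ -1ℤ ℤ.* s ℤ.* y ℤ.* z ℤ.- s ℤ.* x ℤ.* z
  split = solve-∀

term-diagonal : ∀ h d k → term h d k k ≡ + h k
term-diagonal h d k rewrite ℤ.+-inverseʳ k = ℤ.*-identityˡ (+ h k)

β-below : ∀ h d k → k ℤ.< bottom h → β h d k ≡ 0ℤ
β-below h d k k<b =
  cong (λ x → ∑[ i < ∣ x ∣ ] term (fun h) d k (bottom h ℤ.+ + toℕ i))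
    (ℤ.i≤j⇒i⊔j≡j (ℤ.i≤j⇒i-j≤0 (ℤ.i<j⇒suc[i]≤j k<b)))

sumBetween-+ : ∀ b n f →
  sumBetween b (b ℤ.+ + n) f ≡ ∑[ i < suc n ] f (b ℤ.+ + toℕ i)
sumBetween-+ b n f =
  cong (λ x → ∑[ i < ∣ x ℤ.⊔ 0ℤ ∣ ] f (b ℤ.+ + toℕ i)) (count b (+ n))
  where
  count : ∀ b n → 1ℤ ℤ.+ (b ℤ.+ n) ℤ.- b ≡ 1ℤ ℤ.+ n
  count = solve-∀

sumBetween-pred : ∀ b n f →
  sumBetween b (b ℤ.+ + n ℤ.- 1ℤ) f ≡ ∑[ i < n ] f (b ℤ.+ + toℕ i)
sumBetween-pred b n f = trans
  (cong (λ x → ∑[ i < ∣ x ℤ.⊔ 0ℤ ∣ ] f (b ℤ.+ + toℕ i)) (count b (+ n)))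
  (cong (λ m → ∑[ i < m ] f (b ℤ.+ + toℕ i)) (ℕ.⊔-identityʳ n))
  where
  count : ∀ b n → 1ℤ ℤ.+ (b ℤ.+ n ℤ.- 1ℤ) ℤ.- b ≡ n
  count = solve-∀

≤⇒≡+ : ∀ {i j} → i ℤ.≤ j → j ≡ i ℤ.+ + ∣ j ℤ.- i ∣
≤⇒≡+ {i} {j} i≤j = sym (trans
  (cong (λ x → i ℤ.+ x) (ℤ.0≤i⇒+∣i∣≡i (ℤ.i≤j⇒0≤j-i i≤j))) (cancel i j))
  where
  cancel : ∀ i j → i ℤ.+ (j ℤ.- i) ≡ j
  cancel = solve-∀

β-pascal-+ : ∀ h n e → let k = bottom h ℤ.+ + n ; d = k ℤ.+ + e in
  β h (1ℤ ℤ.+ d) k ≡ β h d k ℤ.- β h d (k ℤ.- 1ℤ)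
β-pascal-+ h n e = begin
  β h (1ℤ ℤ.+ d) k
    ≡⟨ sumBetween-+ b n (term (fun h) (1ℤ ℤ.+ d) k) ⟩
  ∑[ i < suc n ] t (1ℤ ℤ.+ d) k (toℕ i)
    ≡⟨ ∑-difference n (t (1ℤ ℤ.+ d) k) (t d k) (t d (k ℤ.- 1ℤ))
         (λ i r n≡ → term-pascal (fun h) k e (b ℤ.+ + i) r (k≡ i r n≡))
         -- The summand at `j = k` does not depend on `d`, and the sum for `k - 1` has no
         -- counterpart to it.
         (trans (term-diagonal (fun h) (1ℤ ℤ.+ d) k)
                (sym (term-diagonal (fun h) d k))) ⟩
  ∑[ i < suc n ] t d k (toℕ i) ℤ.- ∑[ i < n ] t d (k ℤ.- 1ℤ) (toℕ i)
    ≡⟨ cong₂ ℤ._-_ (sumBetween-+ b n (term (fun h) d k))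
                   (sumBetween-pred b n (term (fun h) d (k ℤ.- 1ℤ))) ⟨
  β h d k ℤ.- β h d (k ℤ.- 1ℤ) ∎
  where
  open ≡-Reasoning
  b = bottom h
  k = b ℤ.+ + n
  d = k ℤ.+ + e
  t : ℤ → ℤ → ℕ → ℤ
  t d k i = term (fun h) d k (b ℤ.+ + i)
  assoc : ∀ b i r → b ℤ.+ (1ℤ ℤ.+ (i ℤ.+ r)) ≡ b ℤ.+ i ℤ.+ (1ℤ ℤ.+ r)
  assoc = solve-∀
  k≡ : ∀ i r → n ≡ suc (i ℕ.+ r) → k ≡ b ℤ.+ + i ℤ.+ + suc r
  k≡ i r n≡ = trans (cong (λ m → b ℤ.+ + m) n≡) (assoc b (+ i) (+ r))

k-1<k : ∀ k → k ℤ.- 1ℤ ℤ.< k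
k-1<k k = ℤ.i≤pred[j]⇒i<j (ℤ.≤-reflexive (ℤ.+-comm k -1ℤ))

β-pascal : ∀ h d k → k ℤ.≤ d →
  β h (1ℤ ℤ.+ d) k ≡ β h d k ℤ.- β h d (k ℤ.- 1ℤ)
β-pascal h d k k≤d with k ℤ.<? bottom h
-- Below `bottom` all three sums are empty, and the rule reads `0 = 0 - 0`.
... | yes k<b rewrite β-below h (1ℤ ℤ.+ d) k k<b | β-below h d k k<b
                    | β-below h d (k ℤ.- 1ℤ)
                        (ℤ.<-trans (k-1<k k) k<b) = refl
... | no  k≮b = subst₂ (λ k d → β h (1ℤ ℤ.+ d) k ≡ β h d k ℤ.- β h d (k ℤ.- 1ℤ))
  (sym k≡) (trans (cong (ℤ._+ + ∣ d ℤ.- k ∣) (sym k≡)) (sym (≤⇒≡+ k≤d)))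
  (β-pascal-+ h ∣ k ℤ.- bottom h ∣ ∣ d ℤ.- k ∣)
  where k≡ = ≤⇒≡+ (ℤ.≮⇒≥ k≮b)

-- Admissibility passes to smaller degrees.

admissible-pred : ∀ h d → Admissible h (1ℤ ℤ.+ d) → Admissible h d
admissible-pred h d adm k k≤d =
  -- Any `n` with `k < bottom h + n` starts the induction. The maximum keeps the difference
  -- nonnegative when `k` lies below `bottom h`.
  go ∣ 1ℤ ℤ.+ (k ℤ.⊔ bottom h) ℤ.- bottom h ∣ k k≤d
    (subst (k ℤ.<_) (≤⇒≡+ (ℤ.≤-trans (ℤ.i≤j⊔i k b) (ℤ.i≤suc[i] _)))
      (ℤ.≤-<-trans (ℤ.i≤i⊔j k b) (ℤ.suc[i]≤j⇒i<j ℤ.≤-refl)))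
  where
  b = bottom h

  go : ∀ n k → k ℤ.≤ d → k ℤ.< b ℤ.+ + n → 0ℤ ℤ.≤ β h d k
  go zero    k k≤d k< = ℤ.≤-reflexive
    (sym (β-below h d k (subst (k ℤ.<_) (ℤ.+-identityʳ b) k<)))
  go (suc n) k k≤d k< = subst (0ℤ ℤ.≤_) recover
    (ℤ.+-mono-≤ (adm k (ℤ.≤-trans k≤d (ℤ.i≤suc[i] d)))
                (go n (k ℤ.- 1ℤ) (ℤ.≤-trans (ℤ.<⇒≤ (k-1<k k)) k≤d) k-1<))
    where
    shift : ∀ b n → b ℤ.+ (1ℤ ℤ.+ n) ℤ.- 1ℤ ≡ b ℤ.+ n
    shift = solve-∀
    k-1< : k ℤ.- 1ℤ ℤ.< b ℤ.+ + n
    k-1< = subst (k ℤ.- 1ℤ ℤ.<_) (shift b (+ n)) (ℤ.+-monoˡ-< -1ℤ k<)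
    cancel : ∀ x y → x ℤ.- y ℤ.+ y ≡ x
    cancel = solve-∀
    recover : β h (1ℤ ℤ.+ d) k ℤ.+ β h d (k ℤ.- 1ℤ) ≡ β h d k
    recover = trans (cong (ℤ._+ β h d (k ℤ.- 1ℤ)) (β-pascal h d k k≤d))
                    (cancel (β h d k) _)

admissible-downward : ∀ h {m d} → m ℤ.≤ d → Admissible h d → Admissible h m
admissible-downward h {m} {d} m≤d adm =
  go ∣ d ℤ.- m ∣ (subst (Admissible h) (≤⇒≡+ m≤d) adm)
  where
  shift : ∀ m n → m ℤ.+ (1ℤ ℤ.+ n) ≡ 1ℤ ℤ.+ (m ℤ.+ n)
  shift = solve-∀
  go : ∀ n → Admissible h (m ℤ.+ + n) → Admissible h m
  go zero    p = subst (Admissible h) (ℤ.+-identityʳ m) p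
  go (suc n) p =
    go n (admissible-pred h _ (subst (Admissible h) (shift m (+ n)) p))

-- An admissible `d` above `m` would, by downward closure, make `1 + m` admissible. So one failing
-- degree bounds all larger ones.
hDepth-from-step : ∀ h {m} →
  Admissible h m → ¬ Admissible h (1ℤ ℤ.+ m) → HDepth h m
hDepth-from-step h {m} adm ¬adm = adm , λ d p → ℤ.≮⇒≥ λ m<d →
  ¬adm (admissible-downward h (ℤ.i<j⇒suc[i]≤j m<d) p)

-- `β` of a linear function as a combination of `a` and `b`.

weight : (d k j : ℤ) → ℤ
weight d k j = -1ℤ ℤ.^ ∣ k ℤ.- j ∣ ℤ.* + (∣ d ℤ.- j ∣ C ∣ k ℤ.- j ∣)

-- Free of `a` and `b`, these evaluate to integer literals at literal `d` and `k`, so each `β`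
-- needed below becomes an explicit linear form by computation.
moment₀ moment₁ : (d k : ℤ) → ℤ
moment₀ d k = sumBetween 0ℤ k (weight d k)
moment₁ d k = sumBetween 0ℤ k (λ j → weight d k j ℤ.* j)

β-linear : ∀ a b .{{_ : NonZero b}} d k →
  β (linear a b) d k ≡ + a ℤ.* moment₁ d k ℤ.+ + b ℤ.* moment₀ d k
β-linear a b d k = begin
  ∑[ i < n ] (w i ℤ.* + (a * toℕ i ℕ.+ b))
    ≡⟨ sum-cong-≗ {n} (λ i → trans
         (cong (λ x → w i ℤ.* (x ℤ.+ + b)) (ℤ.pos-* a (toℕ i)))
         (distribute (w i) (+ a) (+ toℕ i) (+ b))) ⟩
  ∑[ i < n ] (+ a ℤ.* (w i ℤ.* + toℕ i) ℤ.+ + b ℤ.* w i)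
    ≡⟨ ∑-distrib-+ {n} (λ i → + a ℤ.* (w i ℤ.* + toℕ i)) (λ i → + b ℤ.* w i) ⟩
  ∑[ i < n ] (+ a ℤ.* (w i ℤ.* + toℕ i)) ℤ.+ ∑[ i < n ] (+ b ℤ.* w i)
    ≡⟨ cong₂ ℤ._+_ (*-distribˡ-sum {n} (+ a) (λ i → w i ℤ.* + toℕ i))
                   (*-distribˡ-sum {n} (+ b) w) ⟨
  + a ℤ.* moment₁ d k ℤ.+ + b ℤ.* moment₀ d k ∎
  where
  open ≡-Reasoning
  n = ∣ (1ℤ ℤ.+ k ℤ.- 0ℤ) ℤ.⊔ 0ℤ ∣
  w : Fin.Fin n → ℤ
  w i = weight d k (+ toℕ i)
  distribute : ∀ w a i b →
    w ℤ.* (a ℤ.* i ℤ.+ b) ≡ a ℤ.* (w ℤ.* i) ℤ.+ b ℤ.* w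
  distribute = solve-∀

module _ (a b : ℕ) .{{_ : NonZero b}} where

  -- The left side has the shape to which the moments evaluate when the coefficient of `b` is
  -- negative; `0≤nb-ma` serves a negative coefficient of `a`.
  0≤ma-nb : ∀ m n →
    0ℤ ℤ.≤ + a ℤ.* + m ℤ.+ + b ℤ.* - + n ⇔ n * b ≤ m * a
  0≤ma-nb m n = mk⇔
    (λ p → ℤ.drop‿+≤+ (ℤ.0≤i-j⇒j≤i (subst (0ℤ ℤ.≤_) (sym eq) p)))
    (λ p → subst (0ℤ ℤ.≤_) eq (ℤ.i≤j⇒0≤j-i (+≤+ p)))
    where
    commute : ∀ m a n b → m ℤ.* a ℤ.- n ℤ.* b ≡ a ℤ.* m ℤ.+ b ℤ.* - n
    commute = solve-∀
    eq : + (m * a) ℤ.- + (n * b) ≡ + a ℤ.* + m ℤ.+ + b ℤ.* - + n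
    eq = trans (cong₂ ℤ._-_ (ℤ.pos-* m a) (ℤ.pos-* n b))
               (commute (+ m) (+ a) (+ n) (+ b))

  0≤nb-ma : ∀ m n →
    0ℤ ℤ.≤ + a ℤ.* - + m ℤ.+ + b ℤ.* + n ⇔ m * a ≤ n * b
  0≤nb-ma m n = mk⇔
    (λ p → ℤ.drop‿+≤+ (ℤ.0≤i-j⇒j≤i (subst (0ℤ ℤ.≤_) (sym eq) p)))
    (λ p → subst (0ℤ ℤ.≤_) eq (ℤ.i≤j⇒0≤j-i (+≤+ p)))
    where
    commute : ∀ m a n b → n ℤ.* b ℤ.- m ℤ.* a ≡ a ℤ.* - m ℤ.+ b ℤ.* n
    commute = solve-∀
    eq : + (n * b) ℤ.- + (m * a) ≡ + a ℤ.* - + m ℤ.+ + b ℤ.* + n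
    eq = trans (cong₂ ℤ._-_ (ℤ.pos-* n b) (ℤ.pos-* m a))
               (commute (+ m) (+ a) (+ n) (+ b))

  private
    lin : HFunction
    lin = linear a b

    a≡1a : a ≡ 1 * a
    a≡1a = sym (ℕ.*-identityˡ a)

    β-nonneg : ∀ d k → 0ℤ ℤ.≤ + a ℤ.* moment₁ d k ℤ.+ + b ℤ.* moment₀ d k →
      0ℤ ℤ.≤ β lin d k
    β-nonneg d k = subst (0ℤ ℤ.≤_) (sym (β-linear a b d k))

    combination-nonneg : ∀ {d} → Admissible lin d → ∀ k → k ℤ.≤ d →
      0ℤ ℤ.≤ + a ℤ.* moment₁ d k ℤ.+ + b ℤ.* moment₀ d k
    combination-nonneg {d} adm k k≤d =
      subst (0ℤ ℤ.≤_) (β-linear a b d k) (adm k k≤d)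

    0≤ma+nb : ∀ m n → 0ℤ ℤ.≤ + a ℤ.* + m ℤ.+ + b ℤ.* + n
    0≤ma+nb m n = subst (0ℤ ℤ.≤_)
      (cong₂ ℤ._+_ (ℤ.pos-* a m) (ℤ.pos-* b n)) (+≤+ z≤n)

    β-negative : ∀ d k → 0ℤ ℤ.≤ β lin d ℤ.-[1+ k ]
    β-negative d k = ℤ.≤-reflexive (sym (β-below lin d ℤ.-[1+ k ] ℤ.-<+))

  -- Sufficient conditions for degrees 1 to 4.

  admissible-1 : Admissible lin (+ 1)
  admissible-1 (+ 0)              _ = β-nonneg (+ 1) (+ 0) (0≤ma+nb 0 1)
  admissible-1 (+ 1)              _ = β-nonneg (+ 1) (+ 1) (0≤ma+nb 1 0)
  admissible-1 (+ suc (suc _))    (+≤+ (s≤s ()))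
  admissible-1 ℤ.-[1+ k ]         _ = β-negative (+ 1) k

  admissible-2 : b ≤ a → Admissible lin (+ 2)
  admissible-2 b≤a (+ 0) _ = β-nonneg (+ 2) (+ 0) (0≤ma+nb 0 1)
  admissible-2 b≤a (+ 1) _ = β-nonneg (+ 2) (+ 1)
    (from (0≤ma-nb 1 1) (ℕ.*-monoʳ-≤ 1 b≤a))
  admissible-2 b≤a (+ 2) _ = β-nonneg (+ 2) (+ 2) (0≤ma+nb 1 1)
  admissible-2 b≤a (+ suc (suc (suc _))) (+≤+ (s≤s (s≤s ())))
  admissible-2 b≤a ℤ.-[1+ k ] _ = β-negative (+ 2) k

  -- For `k` from 0 to 3 the values are b, a - 2b, 2b and 2a, so only `k = 1` needs the hypothesis.
  admissible-3 : 2 * b ≤ a → Admissible lin (+ 3)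
  admissible-3 2b≤a (+ 0) _ = β-nonneg (+ 3) (+ 0) (0≤ma+nb 0 1)
  admissible-3 2b≤a (+ 1) _ = β-nonneg (+ 3) (+ 1)
    (from (0≤ma-nb 1 2) (subst (2 * b ≤_) a≡1a 2b≤a))
  admissible-3 2b≤a (+ 2) _ = β-nonneg (+ 3) (+ 2) (0≤ma+nb 0 2)
  admissible-3 2b≤a (+ 3) _ = β-nonneg (+ 3) (+ 3) (0≤ma+nb 2 0)
  admissible-3 2b≤a (+ suc (suc (suc (suc _)))) (+≤+ (s≤s (s≤s (s≤s ()))))
  admissible-3 2b≤a ℤ.-[1+ k ] _ = β-negative (+ 3) k

  -- For `k` from 0 to 4 the values are b, a - 3b, 4b - a, 2a - 2b and 2a + b. The hypotheses settle
  -- `k = 1` and `k = 2`; `k = 3` follows from b ≤ 3b ≤ a.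
  admissible-4 : 3 * b ≤ a → a ≤ 4 * b → Admissible lin (+ 4)
  admissible-4 3b≤a a≤4b (+ 0) _ = β-nonneg (+ 4) (+ 0) (0≤ma+nb 0 1)
  admissible-4 3b≤a a≤4b (+ 1) _ = β-nonneg (+ 4) (+ 1)
    (from (0≤ma-nb 1 3) (subst (3 * b ≤_) a≡1a 3b≤a))
  admissible-4 3b≤a a≤4b (+ 2) _ = β-nonneg (+ 4) (+ 2)
    (from (0≤nb-ma 1 4) (subst (_≤ 4 * b) a≡1a a≤4b))
  admissible-4 3b≤a a≤4b (+ 3) _ = β-nonneg (+ 4) (+ 3)
    (from (0≤ma-nb 2 2) (ℕ.*-monoʳ-≤ 2 (ℕ.≤-trans (ℕ.m≤n*m b 3) 3b≤a)))
  admissible-4 3b≤a a≤4b (+ 4) _ = β-nonneg (+ 4) (+ 4) (0≤ma+nb 2 1)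
  admissible-4 3b≤a a≤4b (+ suc (suc (suc (suc (suc _)))))
    (+≤+ (s≤s (s≤s (s≤s (s≤s ())))))
  admissible-4 3b≤a a≤4b ℤ.-[1+ k ] _ = β-negative (+ 4) k

  -- Obstructions, read off at `k = 1` and `k = 2`.

  admissible-2⇒b≤a : Admissible lin (+ 2) → b ≤ a
  admissible-2⇒b≤a adm = ℕ.*-cancelˡ-≤ 1
    (to (0≤ma-nb 1 1) (combination-nonneg adm (+ 1) (+≤+ (s≤s z≤n))))

  admissible-3⇒2b≤a : Admissible lin (+ 3) → 2 * b ≤ a
  admissible-3⇒2b≤a adm = subst (2 * b ≤_) (sym a≡1a)
    (to (0≤ma-nb 1 2) (combination-nonneg adm (+ 1) (+≤+ (s≤s z≤n))))

  admissible-4⇒3b≤a : Admissible lin (+ 4) → 3 * b ≤ a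
  admissible-4⇒3b≤a adm = subst (3 * b ≤_) (sym a≡1a)
    (to (0≤ma-nb 1 3) (combination-nonneg adm (+ 1) (+≤+ (s≤s z≤n))))

  admissible-4⇒a≤4b : Admissible lin (+ 4) → a ≤ 4 * b
  admissible-4⇒a≤4b adm = subst (_≤ 4 * b) (sym a≡1a)
    (to (0≤nb-ma 1 4) (combination-nonneg adm (+ 2) (+≤+ (s≤s (s≤s z≤n)))))

  ¬admissible-5 : ¬ Admissible lin (+ 5)
  ¬admissible-5 adm = ℕ.1+n≰n (ℕ.*-cancelʳ-≤ 8 7 b 8b≤7b)
    where
    4b≤1a : 4 * b ≤ 1 * a
    4b≤1a = to (0≤ma-nb 1 4)
      (combination-nonneg adm (+ 1) (+≤+ (s≤s z≤n)))
    2a≤7b : 2 * a ≤ 7 * b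
    2a≤7b = to (0≤nb-ma 2 7)
      (combination-nonneg adm (+ 2) (+≤+ (s≤s (s≤s z≤n))))
    -- Doubling 4b ≤ a gives 8b ≤ 2a ≤ 7b, which is impossible for positive b.
    8b≤7b : 8 * b ≤ 7 * b
    8b≤7b = ℕ.≤-trans (ℕ.≤-reflexive (ℕ.*-assoc 2 4 b))
      (ℕ.≤-trans (ℕ.*-monoʳ-≤ 2 (subst (4 * b ≤_) (sym a≡1a) 4b≤1a)) 2a≤7b)

theorem3p5 : ∀ (a b : ℕ) .{{_ : NonZero a}} .{{_ : NonZero b}} →
    (a < b → HDepth (linear a b) (+ 1)) ×
    (b ≤ a × a < 2 * b → HDepth (linear a b) (+ 2)) ×
    (2 * b ≤ a × a < 3 * b → HDepth (linear a b) (+ 3)) ×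
    (3 * b ≤ a × a ≤ 4 * b → HDepth (linear a b) (+ 4)) ×
    (a > 4 * b → HDepth (linear a b) (+ 3))
theorem3p5 a b =
  (λ a<b → hDepth-from-step (linear a b) (admissible-1 a b)
    λ adm → ℕ.<⇒≱ a<b (admissible-2⇒b≤a a b adm)) ,
  (λ { (b≤a , a<2b) → hDepth-from-step (linear a b) (admissible-2 a b b≤a)
    λ adm → ℕ.<⇒≱ a<2b (admissible-3⇒2b≤a a b adm) }) ,
  (λ { (2b≤a , a<3b) → hDepth-from-step (linear a b) (admissible-3 a b 2b≤a)
    λ adm → ℕ.<⇒≱ a<3b (admissible-4⇒3b≤a a b adm) }) ,
  (λ { (3b≤a , a≤4b) → hDepth-from-step (linear a b)
    (admissible-4 a b 3b≤a a≤4b) (¬admissible-5 a b) }) ,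
  -- For large a, degree 4 fails at `k = 2` instead of `k = 1`, while 2b ≤ 4b < a keeps degree 3
  -- admissible.
  (λ 4b<a → hDepth-from-step (linear a b)
    (admissible-3 a b (ℕ.≤-trans (ℕ.*-monoˡ-≤ b {2} {4} (s≤s (s≤s z≤n)))
                                (ℕ.<⇒≤ 4b<a)))
    λ adm → ℕ.<⇒≱ 4b<a (admissible-4⇒a≤4b a b adm))
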